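{- Let $N\ge 3$ and let $x\in\mathfrak{A}_N$ have only cycles of odd length. Then the interval $[e,x]_{\mathbf 3}$ of $(\mathfrak{A}_N,\le_{\mathbf 3})$ is an induced subposet of the interval $[e,x]_{\mathbf 2}$ of $(\mathfrak{S}_N,\le_{\mathbf 2})$; that is, $[e,x]_{\mathbf 3}\subseteq[e,x]_{\mathbf 2}$ and for all $y,z\in[e,x]_{\mathbf 3}$ one has $y\le_{\mathbf 3}z$ if and only if $y\le_{\mathbf 2}z$.
   Context: $\mathfrak{S}_N$ is the symmetric group on $[N]=\{1,\dots,N\}$, $\mathfrak{A}_N$ the alternating group, $e$ the identity. Cycles of a permutation include its fixed points (length $1$, hence odd). For $x\in\mathfrak{S}_N$, $\ell_{\mathbf 2}(x)$ is the minimal number of transpositions with product $x$, and $x\le_{\mathbf 2}y$ iff $\ell_{\mathbf 2}(y)=\ell_{\mathbf 2}(x)+\ell_{\mathbf 2}(x^{ -1}y)$. For $x\in\mathfrak{A}_N$, $\ell_{\mathbf 3}(x)$ is the minimal number of $3$-cycles with product $x$, and $x\le_{\mathbf 3}y$ iff $\ell_{\mathbf 3}(y)=\ell_{\mathbf 3}(x)+\ell_{\mathbf 3}(x^{ -1}y)$. $[u,v]_{\mathbf i}=\{w: u\le_{\mathbf i}w\le_{\mathbf i}v\}$. -}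

module Defs where

open import Data.Nat using (ℕ; zero; suc; _+_; _≤_; _<_)
open import Data.Nat using (_*_)
open import Data.Fin using (Fin)
open import Data.Fin.Permutation using (Permutation′; _⟨$⟩ʳ_; _≈_; id; flip; _∘ₚ_; transpose)
open import Data.List using (List; []; _∷_; length)
open import Data.List.Relation.Unary.All using (All)
open import Data.Product using (Σ; ∃; _×_; _,_)
open import Relation.Binary.PropositionalEquality using (_≡_; _≢_)
open import Relation.Nullary using (¬_)

Even : ℕ → Set
Even k = ∃ λ m → k ≡ 2 * m

Odd : ℕ → Set
Odd k = ∃ λ m → k ≡ suc (2 * m)

-- Permutations of [N] (modelled as Fin N), i.e. elements of 𝔖_N.
-- Equality of permutations is pointwise equality _≈_.
Perm : ℕ → Set
Perm N = Permutation′ N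

-- Product in 𝔖_N, usual right-to-left convention: (x · y)(i) = x (y i).
-- (_∘ₚ_ of the library is diagrammatic: (π ∘ₚ ρ)(i) = ρ (π i).)
infixl 7 _·_
_·_ : ∀ {N} → Perm N → Perm N → Perm N
x · y = y ∘ₚ x

_⁻¹ : ∀ {N} → Perm N → Perm N
x ⁻¹ = flip x

e : ∀ {N} → Perm N
e = id

prod : ∀ {N} → List (Perm N) → Perm N
prod []       = e
prod (t ∷ ts) = t · prod ts

IsTransposition : ∀ {N} → Perm N → Set
IsTransposition {N} t = Σ (Fin N) λ i → Σ (Fin N) λ j → i ≢ j × t ≈ transpose i j

-- t is a 3-cycle (a b c) : a ↦ b ↦ c ↦ a, with a, b, c pairwise distinct
-- (all other points fixed).
threeCycle : ∀ {N} → Fin N → Fin N → Fin N → Perm N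
threeCycle a b c = transpose a b · transpose b c

IsThreeCycle : ∀ {N} → Perm N → Set
IsThreeCycle {N} t = Σ (Fin N) λ a → Σ (Fin N) λ b → Σ (Fin N) λ c →
  a ≢ b × b ≢ c × a ≢ c × t ≈ threeCycle a b c

ProdOf : ∀ {N} → (Perm N → Set) → Perm N → ℕ → Set
ProdOf {N} G x k = Σ (List (Perm N)) λ ts → All G ts × length ts ≡ k × x ≈ prod ts

MinLen : ∀ {N} → (Perm N → Set) → Perm N → ℕ → Set
MinLen G x k = ProdOf G x k × (∀ m → ProdOf G x m → k ≤ m)

Len₂ : ∀ {N} → Perm N → ℕ → Set
Len₂ = MinLen IsTransposition

-- ℓ₃(x) = k  (only satisfiable for x ∈ 𝔄_N)
Len₃ : ∀ {N} → Perm N → ℕ → Set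
Len₃ = MinLen IsThreeCycle

_≤₂_ : ∀ {N} → Perm N → Perm N → Set
x ≤₂ y = Σ ℕ λ a → Σ ℕ λ b → Σ ℕ λ c →
  Len₂ y a × Len₂ x b × Len₂ (x ⁻¹ · y) c × a ≡ b + c

-- x ≤₃ y  iff  ℓ₃(y) = ℓ₃(x) + ℓ₃(x⁻¹ y)   (x, y ∈ 𝔄_N, enforced by
-- the existence of the lengths)
_≤₃_ : ∀ {N} → Perm N → Perm N → Set
x ≤₃ y = Σ ℕ λ a → Σ ℕ λ b → Σ ℕ λ c →
  Len₃ y a × Len₃ x b × Len₃ (x ⁻¹ · y) c × a ≡ b + c

_∈[_,_]₂ : ∀ {N} → Perm N → Perm N → Perm N → Set
w ∈[ u , v ]₂ = u ≤₂ w × w ≤₂ v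

_∈[_,_]₃ : ∀ {N} → Perm N → Perm N → Perm N → Set
w ∈[ u , v ]₃ = u ≤₃ w × w ≤₃ v

InAlt : ∀ {N} → Perm N → Set
InAlt x = ∃ λ k → ProdOf IsTransposition x k × Even k

pow : ∀ {N} → Perm N → ℕ → Fin N → Fin N
pow x zero    i = i
pow x (suc k) i = x ⟨$⟩ʳ pow x k i

CycleLen : ∀ {N} → Perm N → Fin N → ℕ → Set
CycleLen x i k = 1 ≤ k × pow x k i ≡ i × (∀ m → 1 ≤ m → m < k → pow x m i ≢ i)

OnlyOddCycles : ∀ {N} → Perm N → Set
OnlyOddCycles {N} x = ∀ (i : Fin N) (k : ℕ) → CycleLen x i k → Odd k

{-# OPTIONS --safe #-}
module Submission where

-- Write rk for ℓ₂, that is N minus the number of cycles. Left multiplication by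
-- a transposition (i j) merges two cycles (rk + 1) or splits one (rk − 1), so
-- rk w ≤ 2 ℓ₃(w), with equality exactly when all cycles of w are odd. For y ≤₃ x with
-- x odd-cycled this forces rk to be additive and y, y⁻¹x to be odd-cycled, which gives
-- everything except y ≤₂ z ⇒ y ≤₃ z. There one must show that w = y⁻¹z has only
-- odd cycles, knowing that x = y w u with rk additive and that y w and w u
-- are odd-cycled, where u = z⁻¹x. Peeling 3-cycles off y and u reduces this to the case
-- where y and u are 3-cycles: y merges three cycles of w into an odd one, so if w had
-- an even cycle, y would merge exactly two; these are then also merged by u, and
-- y w u could not have rank rk w + 4.

open import Defs
open import Algebra.Bundles using (CommutativeRing)
open import Data.Bool using (Bool; true; false; _xor_)
open import Data.Bool.Properties using (xor-∧-commutativeRing; xor-assoc; xor-comm)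
open import Algebra.Properties.CommutativeMonoid.Sum (CommutativeRing.+-commutativeMonoid xor-∧-commutativeRing)
  using (sum; sum-cong-≗; sum-replicate-zero; ∑-distrib-+)
open import Data.Nat using (ℕ; zero; suc; _+_; _*_; _≤_; _<_; z≤n; s≤s)
open import Data.Nat.Properties using (suc-injective; ≤-refl; ≤-reflexive; ≤-trans; ≤-antisym; ≤-pred; n≤1+n; m<n⇒m<1+n; m<1+n⇒m<n∨m≡n;
  m≤n⇒∃[o]m+o≡n; +-suc; +-assoc; +-comm; +-identityʳ; +-monoʳ-≤; +-cancelˡ-≤; +-cancelʳ-≤; +-monoˡ-≤) renaming (_≟_ to _≟ℕ_)
open import Data.Fin using (Fin; zero; suc; toℕ)
open import Data.Fin.Properties using (_≟_; all?; ¬∀⟶∃¬; pigeonhole) renaming (suc-injective to sucᶠ-injective)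
open import Data.Fin.Permutation.Components using () renaming (transpose to swap)
open import Data.Fin.Permutation using (_⟨$⟩ʳ_; _⟨$⟩ˡ_; _≈_; transpose; inverseˡ; inverseʳ)
open import Data.List using (List; []; _∷_; length)
open import Data.List.Relation.Unary.All using (All; []; _∷_)
open import Data.Product using (∃; _×_; _,_; proj₁; proj₂)
open import Data.Sum using (_⊎_; inj₁; inj₂)
open import Data.Empty using (⊥-elim)
open import Function.Base using (_∘_)
open import Function.Bundles using (_⇔_; mk⇔)
open import Function.Definitions using (Injective)
open import Relation.Nullary using (¬_; Dec; yes; no; does)
open import Relation.Nullary.Decidable using (dec-true; dec-false)
open import Relation.Binary.PropositionalEquality using (_≡_; _≢_; _≗_; refl; sym; trans; cong; cong₂)

-- Injections and transpositions of `Fin N`.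

Inj : ∀ {N} → (Fin N → Fin N) → Set
Inj = Injective _≡_ _≡_

swap-left : ∀ {N} (i j : Fin N) → swap i j i ≡ j
swap-left i j with i ≟ i
... | yes _ = refl
... | no ne = ⊥-elim (ne refl)

swap-right : ∀ {N} (i j : Fin N) → swap i j j ≡ i
swap-right i j with j ≟ i
... | yes j≡i = j≡i
... | no _ with j ≟ j
...   | yes _ = refl
...   | no ne = ⊥-elim (ne refl)

swap-other : ∀ {N} {i j k : Fin N} → k ≢ i → k ≢ j → swap i j k ≡ k
swap-other {i = i} {j} {k} k≢i k≢j with k ≟ i
... | yes k≡i = ⊥-elim (k≢i k≡i)
... | no _ with k ≟ j
...   | yes k≡j = ⊥-elim (k≢j k≡j)
...   | no _ = refl

data SwapCase {N} (i j k : Fin N) : Set where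
  left  : k ≡ i → swap i j k ≡ j → SwapCase i j k
  right : k ≡ j → swap i j k ≡ i → SwapCase i j k
  other : k ≢ i → k ≢ j → swap i j k ≡ k → SwapCase i j k

swapCase : ∀ {N} (i j k : Fin N) → SwapCase i j k
swapCase i j k with k ≟ i
... | yes refl = left refl (swap-left i j)
... | no k≢i with k ≟ j
...   | yes refl = right refl (swap-right i j)
...   | no k≢j = other k≢i k≢j (swap-other k≢i k≢j)

swap-comm : ∀ {N} (i j k : Fin N) → swap i j k ≡ swap j i k
swap-comm i j k with swapCase i j k
... | left refl p = trans p (sym (swap-right j i))
... | right refl p = trans p (sym (swap-left j i))
... | other k≢i k≢j p = trans p (sym (swap-other k≢j k≢i))

swap-involutive : ∀ {N} (i j k : Fin N) → swap i j (swap i j k) ≡ k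
swap-involutive i j k with swapCase i j k
... | left refl p = trans (cong (swap i j) p) (swap-right i j)
... | right refl p = trans (cong (swap i j) p) (swap-left i j)
... | other _ _ p = trans (cong (swap i j) p) p

swap-suc : ∀ {N} (i j k : Fin N) → swap (suc i) (suc j) (suc k) ≡ suc (swap i j k)
swap-suc i j k with swapCase i j k
... | left refl p = trans (swap-left (suc i) (suc j)) (cong suc (sym p))
... | right refl p = trans (swap-right (suc i) (suc j)) (cong suc (sym p))
... | other k≢i k≢j p =
  trans (swap-other (k≢i ∘ sucᶠ-injective) (k≢j ∘ sucᶠ-injective)) (cong suc (sym p))

swap-natural : ∀ {N} (f : Fin N → Fin N) → Inj f → ∀ i j k →
  f (swap i j k) ≡ swap (f i) (f j) (f k)
swap-natural f inj i j k with swapCase i j k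
... | left refl p = trans (cong f p) (sym (swap-left (f i) (f j)))
... | right refl p = trans (cong f p) (sym (swap-right (f i) (f j)))
... | other k≢i k≢j p = trans (cong f p) (sym (swap-other (k≢i ∘ inj) (k≢j ∘ inj)))

-- Cycle labels and rank by deletion of the point 0.

-- Deleting the point 0 from its cycle turns a permutation of Fin (suc N) into
-- one of Fin N; the last clause of bypass is junk, never met by an injection.

bypass : ∀ {N} → Fin (suc N) → Fin (suc N) → Fin N → Fin N
bypass (suc a) _       k = a
bypass zero    (suc b) k = b
bypass zero    zero    k = k

drop : ∀ {N} → (Fin (suc N) → Fin (suc N)) → Fin N → Fin N
drop f k = bypass (f (suc k)) (f zero) k

at : ∀ {N} → Fin N → Fin (suc N) → Fin N
at m zero    = m
at m (suc k) = k

-- The first argument is the image of 0. If it is `suc m`, then 0 joins the class of `m`; if 0 is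
-- fixed, it needs a fresh label, and the shift keeps `zero` free for it.
extend : ∀ {N} → Fin (suc N) → (Fin N → ℕ) → Fin (suc N) → ℕ
extend zero    ℓ zero    = zero
extend zero    ℓ (suc k) = suc (ℓ k)
extend (suc m) ℓ k       = ℓ (at m k)

-- Two points receive the same label exactly when they lie on the same cycle.
label : ∀ {N} → (Fin N → Fin N) → Fin N → ℕ
label {suc N} f = extend (f zero) (label (drop f))

-- Deleting 0 always removes a point, but removes a cycle only if 0 is fixed; so points minus cycles
-- changes exactly when 0 is moved.
bump : ∀ {N} → Fin (suc N) → ℕ → ℕ
bump zero    r = r
bump (suc _) r = suc r

-- N minus the number of cycles.
rank : ∀ {N} → (Fin N → Fin N) → ℕ
rank {zero}  f = zero
rank {suc N} f = bump (f zero) (rank (drop f))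

0≢suc : ∀ {N} {k : Fin N} → Fin.zero ≢ suc k
0≢suc ()

drop-injective : ∀ {N} {f : Fin (suc N) → Fin (suc N)} → Inj f → Inj (drop f)
drop-injective {f = f} inj {k} {l} = go (f (suc k)) (f (suc l)) (f zero) refl refl refl
  where
  go : ∀ a b c → f (suc k) ≡ a → f (suc l) ≡ b → f zero ≡ c →
       bypass a c k ≡ bypass b c l → k ≡ l
  go (suc a) (suc b) c p q r refl = sucᶠ-injective (inj (trans p (sym q)))
  go zero zero c p q r _ = sucᶠ-injective (inj (trans p (sym q)))
  go zero (suc b) zero p q r _ = ⊥-elim (0≢suc (inj (trans r (sym p))))
  go zero (suc b) (suc c) p q r refl = ⊥-elim (0≢suc (inj (trans r (sym q))))
  go (suc a) zero zero p q r _ = ⊥-elim (0≢suc (inj (trans r (sym q))))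
  go (suc a) zero (suc c) p q r refl = ⊥-elim (0≢suc (inj (trans r (sym p))))

drop-cong : ∀ {N} {f g : Fin (suc N) → Fin (suc N)} → f ≗ g → drop f ≗ drop g
drop-cong f≗g k rewrite f≗g (suc k) | f≗g zero = refl

label-cong : ∀ {N} {f g : Fin N → Fin N} → f ≗ g → label f ≗ label g
label-cong {suc N} {f} {g} f≗g k =
  trans (cong (λ s → extend s (label (drop f)) k) (f≗g zero))
        (extend-cong (g zero) (label-cong (drop-cong f≗g)) k)
  where
  extend-cong : ∀ {N} s {ℓ ℓ′ : Fin N → ℕ} → ℓ ≗ ℓ′ → extend s ℓ ≗ extend s ℓ′
  extend-cong zero    eq zero    = refl
  extend-cong zero    eq (suc k) = cong suc (eq k)
  extend-cong (suc m) eq k       = eq (at m k)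

rank-cong : ∀ {N} {f g : Fin N → Fin N} → f ≗ g → rank f ≡ rank g
rank-cong {zero} f≗g = refl
rank-cong {suc N} {f} {g} f≗g =
  trans (cong (λ s → bump s (rank (drop f))) (f≗g zero))
        (cong (bump (g zero)) (rank-cong (drop-cong f≗g)))

rank-id : ∀ N → rank {N} (λ k → k) ≡ 0
rank-id zero = refl
rank-id (suc N) = rank-id N

label-step : ∀ {N} (f : Fin N → Fin N) → Inj f → ∀ k → label f (f k) ≡ label f k
label-step {suc N} f inj zero with f zero
... | zero  = refl
... | suc m = refl
label-step {suc N} f inj (suc k) = go (f zero) (f (suc k)) refl refl
  where
  ℓ = label (drop f)
  go : ∀ s a → f zero ≡ s → f (suc k) ≡ a → extend s ℓ a ≡ extend s ℓ (suc k)
  go zero zero p q = ⊥-elim (0≢suc (inj (trans p (sym q))))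
  go zero (suc a) p q =
    cong suc (trans (cong ℓ (sym (cong (λ z → bypass z (f zero) k) q)))
                    (label-step (drop f) (drop-injective inj) k))
  -- The cycle runs `suc k`, 0, `suc m`: here 0 carries the label of `m`, and `drop f` sends `k` to
  -- `m`.
  go (suc m) zero p q =
    trans (cong ℓ (sym (trans (cong (λ z → bypass z (f zero) k) q) (cong (λ z → bypass zero z k) p))))
          (label-step (drop f) (drop-injective inj) k)
  go (suc m) (suc a) p q =
    trans (cong ℓ (sym (cong (λ z → bypass z (f zero) k) q)))
          (label-step (drop f) (drop-injective inj) k)

-- An invariant `h` takes equal values at 0 and at its image, so its restriction to the other points
-- is invariant under `drop f`. With `label-step` this identifies label classes with cycles without
-- counting powers of `f`.
invariant⇒label : ∀ {N} {A : Set} (f : Fin N → Fin N) (h : Fin N → A) →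
  (∀ k → h (f k) ≡ h k) → ∀ {i j} → label f i ≡ label f j → h i ≡ h j
invariant⇒label {suc N} f h inv {i} {j} = go (f zero) refl i j
  where
  inv′ : ∀ k → h (suc (drop f k)) ≡ h (suc k)
  inv′ k = at-values (f (suc k)) (f zero) refl refl
    where
    at-values : ∀ a b → f (suc k) ≡ a → f zero ≡ b → h (suc (bypass a b k)) ≡ h (suc k)
    at-values (suc a) b p q = trans (cong h (sym p)) (inv (suc k))
    at-values zero (suc b) p q =
      trans (cong h (sym q)) (trans (inv zero) (trans (cong h (sym p)) (inv (suc k))))
    at-values zero zero p q = refl
  rec : ∀ {i j} → label (drop f) i ≡ label (drop f) j → h (suc i) ≡ h (suc j)
  rec = invariant⇒label (drop f) (h ∘ suc) inv′
  go : ∀ s → f zero ≡ s → ∀ i j →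
       extend s (label (drop f)) i ≡ extend s (label (drop f)) j → h i ≡ h j
  go zero p zero zero _ = refl
  go zero p (suc i) (suc j) eq = rec (suc-injective eq)
  go (suc m) p i j eq = trans (via i) (trans (rec eq) (sym (via j)))
    where
    via : ∀ i → h i ≡ h (suc (at m i))
    via zero = trans (sym (inv zero)) (cong h p)
    via (suc i) = refl

-- Merging and splitting of cycles by a transposition.

-- Only equalities between labels are compared, never their values, because recomputing labels may
-- renumber the classes.
record Merge {N} (ℓ ℓ′ : Fin N → ℕ) (i j : Fin N) : Set where
  field
    apart : ℓ i ≢ ℓ j
    keep  : ∀ {k l} → ℓ k ≡ ℓ l → ℓ′ k ≡ ℓ′ l
    glue  : ℓ′ i ≡ ℓ′ j
    only  : ∀ {k l} → ℓ′ k ≡ ℓ′ l →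
            ℓ k ≡ ℓ l ⊎ (ℓ k ≡ ℓ i × ℓ l ≡ ℓ j) ⊎ (ℓ k ≡ ℓ j × ℓ l ≡ ℓ i)
open Merge

-- In the split case the new partition is not described; where it matters, the step is read
-- backwards, as a merge.
data Outcome {N} (ℓ : Fin N → ℕ) (r : ℕ) (ℓ′ : Fin N → ℕ) (r′ : ℕ) (i j : Fin N) : Set where
  merged : Merge ℓ ℓ′ i j → r′ ≡ suc r → Outcome ℓ r ℓ′ r′ i j
  split  : ℓ i ≡ ℓ j → r ≡ suc r′ → Outcome ℓ r ℓ′ r′ i j

Merge-sym : ∀ {N} {ℓ ℓ′ : Fin N → ℕ} {i j} → Merge ℓ ℓ′ i j → Merge ℓ ℓ′ j i
Merge-sym m .apart eq = apart m (sym eq)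
Merge-sym m .keep = keep m
Merge-sym m .glue = sym (glue m)
Merge-sym m .only eq with only m eq
... | inj₁ p = inj₁ p
... | inj₂ (inj₁ p) = inj₂ (inj₂ p)
... | inj₂ (inj₂ p) = inj₂ (inj₁ p)

Outcome-sym : ∀ {N} {ℓ ℓ′ : Fin N → ℕ} {r r′ i j} → Outcome ℓ r ℓ′ r′ i j → Outcome ℓ r ℓ′ r′ j i
Outcome-sym (merged m p) = merged (Merge-sym m) p
Outcome-sym (split q p) = split (sym q) p

Merge-suc : ∀ {N} {ℓ ℓ′ : Fin N → ℕ} {i j} → Merge ℓ ℓ′ i j →
  Merge (extend zero ℓ) (extend zero ℓ′) (suc i) (suc j)
Merge-suc m .apart eq = apart m (suc-injective eq)
Merge-suc m .keep {zero} {zero} eq = refl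
Merge-suc m .keep {suc k} {suc l} eq = cong suc (keep m (suc-injective eq))
Merge-suc m .glue = cong suc (glue m)
Merge-suc m .only {zero} {zero} eq = inj₁ refl
Merge-suc m .only {suc k} {suc l} eq with only m (suc-injective eq)
... | inj₁ p = inj₁ (cong suc p)
... | inj₂ (inj₁ (p , q)) = inj₂ (inj₁ (cong suc p , cong suc q))
... | inj₂ (inj₂ (p , q)) = inj₂ (inj₂ (cong suc p , cong suc q))

-- Meant for reinserting 0 when it is moved: its image may differ before and after the
-- transposition, whence two maps `ρ` and `ρ′` that need only agree up to the new labels.
Merge-pull : ∀ {M N} {ℓ ℓ′ : Fin N → ℕ} (ρ ρ′ : Fin M → Fin N) {i j} →
  (∀ k → ℓ′ (ρ′ k) ≡ ℓ′ (ρ k)) → Merge ℓ ℓ′ (ρ i) (ρ j) → Merge (ℓ ∘ ρ) (ℓ′ ∘ ρ′) i j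
Merge-pull ρ ρ′ same m .apart = apart m
Merge-pull ρ ρ′ same m .keep eq = trans (same _) (trans (keep m eq) (sym (same _)))
Merge-pull ρ ρ′ same m .glue = trans (same _) (trans (glue m) (sym (same _)))
Merge-pull ρ ρ′ same m .only eq = only m (trans (sym (same _)) (trans eq (same _)))

Merge-new : ∀ {N} (ℓ ℓ′ : Fin N → ℕ) j → ℓ′ ≗ ℓ →
  Merge (extend zero ℓ) (extend (suc j) ℓ′) zero (suc j)
Merge-new ℓ ℓ′ j same .apart ()
Merge-new ℓ ℓ′ j same .keep {zero} {zero} eq = refl
Merge-new ℓ ℓ′ j same .keep {suc k} {suc l} eq =
  trans (same k) (trans (suc-injective eq) (sym (same l)))
Merge-new ℓ ℓ′ j same .glue = refl
Merge-new ℓ ℓ′ j same .only {zero} {zero} eq = inj₁ refl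
Merge-new ℓ ℓ′ j same .only {zero} {suc l} eq =
  inj₂ (inj₁ (refl , cong suc (trans (sym (same l)) (trans (sym eq) (same j)))))
Merge-new ℓ ℓ′ j same .only {suc k} {zero} eq =
  inj₂ (inj₂ (cong suc (trans (sym (same k)) (trans eq (same j))) , refl))
Merge-new ℓ ℓ′ j same .only {suc k} {suc l} eq =
  inj₁ (cong suc (trans (sym (same k)) (trans eq (same l))))

-- Deletion of 0 commutes with a transposition that fixes 0. The values `a` and `b` of an injection
-- are distinct, which excludes the junk clause.
bypass-swap : ∀ {N} (i j k : Fin N) a b → a ≢ b →
  bypass (swap (suc i) (suc j) a) (swap (suc i) (suc j) b) k ≡ swap i j (bypass a b k)
bypass-swap i j k (suc a) b ne rewrite swap-suc i j a = refl
bypass-swap i j k zero (suc b) ne rewrite swap-suc i j b = refl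
bypass-swap i j k zero zero ne = ⊥-elim (ne refl)

-- This and the next two lemmas treat a transposition moving 0, according to whether `f` sends 0 to
-- itself, to `suc j` or to some other `suc m`. In the first two cases the deleted maps agree; in
-- the third they differ by the transposition of `m` and `j`.
bypass-swap-fixed : ∀ {N} (j k : Fin N) a → a ≢ zero →
  bypass (swap zero (suc j) a) (suc j) k ≡ bypass a zero k
bypass-swap-fixed j k zero ne = ⊥-elim (ne refl)
bypass-swap-fixed j k (suc a) ne with a ≟ j
... | yes refl = refl
... | no a≢j = refl

bypass-swap-image : ∀ {N} (j k : Fin N) a → a ≢ suc j →
  bypass (swap zero (suc j) a) zero k ≡ bypass a (suc j) k
bypass-swap-image j k zero ne rewrite swap-left zero (suc j) = refl
bypass-swap-image j k (suc a) ne rewrite swap-other {i = zero} {suc j} {suc a} (λ ()) ne = refl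

bypass-swap-else : ∀ {N} (j m k : Fin N) a → a ≢ suc m →
  bypass (swap zero (suc j) a) (suc m) k ≡ swap m j (bypass a (suc m) k)
bypass-swap-else j m k zero ne rewrite swap-left zero (suc j) = sym (swap-left m j)
bypass-swap-else j m k (suc a) ne with a ≟ j
... | yes refl = sym (swap-right m j)
... | no a≢j =
  sym (swap-other (ne ∘ cong suc) a≢j)

-- Deleting 0 from f and from (i j)f gives maps that agree or again differ by a transposition.
compare : ∀ {N} (f g : Fin N → Fin N) → Inj f → ∀ i j → i ≢ j →
  (∀ k → g k ≡ swap i j (f k)) → Outcome (label f) (rank f) (label g) (rank g) i j

compare₀ : ∀ {N} (f g : Fin (suc N) → Fin (suc N)) → Inj f → ∀ j →
  (∀ k → g k ≡ swap zero (suc j) (f k)) →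
  Outcome (label f) (rank f) (label g) (rank g) zero (suc j)
compare₀ {N} f g inj j eq = go (f zero) (g zero) refl refl
  where
  values : (h : Fin N → Fin N) → ∀ {s s′} → f zero ≡ s → g zero ≡ s′ →
           (∀ k a → a ≢ s → bypass (swap zero (suc j) a) s′ k ≡ h (bypass a s k)) →
           ∀ k → drop g k ≡ h (drop f k)
  values h refl refl hyp k =
    trans (cong (λ z → bypass z (g zero) k) (eq (suc k)))
          (hyp k (f (suc k)) (λ q → 0≢suc (inj (sym q))))
  g0 : ∀ {s} → f zero ≡ s → g zero ≡ swap zero (suc j) s
  g0 p = trans (eq zero) (cong (swap zero (suc j)) p)
  go : ∀ s s′ → f zero ≡ s → g zero ≡ s′ →
       Outcome (extend s (label (drop f))) (bump s (rank (drop f)))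
               (extend s′ (label (drop g))) (bump s′ (rank (drop g))) zero (suc j)
  go zero s′ p q with trans (sym q) (trans (g0 p) (swap-left zero (suc j)))
  ... | refl = merged (Merge-new _ _ j (label-cong same)) (cong suc (rank-cong same))
    where
    same : drop g ≗ drop f
    same = values (λ a → a) p q (bypass-swap-fixed j)
  go (suc m) s′ p q with m ≟ j
  ... | yes refl with trans (sym q) (trans (g0 p) (swap-right zero (suc j)))
  ...   | refl = split refl (cong suc (rank-cong (λ k → sym (same k))))
    where
    same : drop g ≗ drop f
    same = values (λ a → a) p q (bypass-swap-image j)
  go (suc m) s′ p q | no m≢j
    with trans (sym q) (trans (g0 p) (swap-other {i = zero} (λ ()) (m≢j ∘ sucᶠ-injective)))
  -- Since 0 lies on the cycle of its image `suc m`, whether 0 and `suc j` are merged or split is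
  -- decided by `m` and `j`.
  ...   | refl = lift (compare (drop f) (drop g) (drop-injective inj) m j m≢j step)
    where
    step : ∀ k → drop g k ≡ swap m j (drop f k)
    step = values (swap m j) p q (bypass-swap-else j m)
    lift : Outcome (label (drop f)) (rank (drop f)) (label (drop g)) (rank (drop g)) m j →
           Outcome (label (drop f) ∘ at m) (suc (rank (drop f)))
                   (label (drop g) ∘ at m) (suc (rank (drop g))) zero (suc j)
    lift (merged mg r) = merged (Merge-pull (at m) (at m) (λ _ → refl) mg) (cong suc r)
    lift (split sp r) = split sp (cong suc r)

compare {suc N} f g inj zero zero i≢j eq = ⊥-elim (i≢j refl)
compare {suc N} f g inj zero (suc j) i≢j eq = compare₀ f g inj j eq
compare {suc N} f g inj (suc i) zero i≢j eq =
  Outcome-sym (compare₀ f g inj i (λ k → trans (eq k) (swap-comm (suc i) zero (f k))))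
compare {suc N} f g inj (suc i) (suc j) i≢j eq = go (f zero) (g zero) refl refl
  where
  step : ∀ k → drop g k ≡ swap i j (drop f k)
  step k rewrite eq (suc k) | eq zero = bypass-swap i j k _ _ (λ q → 0≢suc (inj (sym q)))
  rec : Outcome (label (drop f)) (rank (drop f)) (label (drop g)) (rank (drop g)) i j
  rec = compare (drop f) (drop g) (drop-injective inj) i j (i≢j ∘ cong suc) step
  go : ∀ s s′ → f zero ≡ s → g zero ≡ s′ →
       Outcome (extend s (label (drop f))) (bump s (rank (drop f)))
               (extend s′ (label (drop g))) (bump s′ (rank (drop g))) (suc i) (suc j)
  go zero s′ p q with trans (sym q) (trans (eq zero) (cong (swap (suc i) (suc j)) p)) | rec
  ... | refl | merged mg r = merged (Merge-suc mg) r
  ... | refl | split sp r = split (cong suc sp) r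
  go (suc m) s′ p q
    with trans (sym q) (trans (eq zero) (trans (cong (swap (suc i) (suc j)) p) (swap-suc i j m))) | rec
  ... | refl | split sp r = split sp (cong suc r)
  ... | refl | merged mg r = merged (Merge-pull (at m) (at (swap i j m)) same mg) (cong suc r)
    where
    same : ∀ k → label (drop g) (at (swap i j m) k) ≡ label (drop g) (at m k)
    same (suc k) = refl
    same zero with swapCase i j m
    ... | left refl h = trans (cong (label (drop g)) h) (sym (glue mg))
    ... | right refl h = trans (cong (label (drop g)) h) (glue mg)
    ... | other _ _ h = cong (label (drop g)) h

-- Parity of cycle lengths.

-- Abstract, since otherwise does (m ≟ n) reduces to m ≡ᵇ n and escapes with-abstraction.
abstract
  _≟ˡ_ : (m n : ℕ) → Dec (m ≡ n)
  _≟ˡ_ = _≟ℕ_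

-- The size of the class of `k` modulo 2, with `true` for odd: `sum` is addition in the field with
-- two elements.
parity : ∀ {N} → (Fin N → ℕ) → Fin N → Bool
parity ℓ k = sum (λ l → does (ℓ k ≟ˡ ℓ l))

AllOdd : ∀ {N} → (Fin N → ℕ) → Set
AllOdd ℓ = ∀ k → parity ℓ k ≡ true

parity-label : ∀ {N} (ℓ : Fin N → ℕ) {k l} → ℓ k ≡ ℓ l → parity ℓ k ≡ parity ℓ l
parity-label ℓ eq = cong (λ c → sum (λ l → does (c ≟ˡ ℓ l))) eq

parity-cong : ∀ {N} {ℓ ℓ′ : Fin N → ℕ} → ℓ ≗ ℓ′ → parity ℓ ≗ parity ℓ′
parity-cong {ℓ = ℓ} {ℓ′} eq k = sum-cong-≗ pointwise
  where
  pointwise : ∀ l → does (ℓ k ≟ˡ ℓ l) ≡ does (ℓ′ k ≟ˡ ℓ′ l)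
  pointwise l rewrite eq k | eq l = refl

sum-δ : ∀ {N} (i : Fin N) → sum (λ l → does (i ≟ l)) ≡ true
sum-δ {suc N} zero = cong (true xor_) (sum-replicate-zero N)
sum-δ {suc N} (suc i) = sum-δ i

parity-singleton : ∀ {N} (ℓ : Fin N → ℕ) i → (∀ l → ℓ i ≡ ℓ l → i ≡ l) → parity ℓ i ≡ true
parity-singleton ℓ i single = trans (sum-cong-≗ pointwise) (sum-δ i)
  where
  pointwise : ∀ l → does (ℓ i ≟ˡ ℓ l) ≡ does (i ≟ l)
  pointwise l with ℓ i ≟ˡ ℓ l | i ≟ l
  ... | yes _ | yes _ = refl
  ... | yes p | no ¬q = ⊥-elim (¬q (single l p))
  ... | no ¬p | yes q = ⊥-elim (¬p (cong ℓ q))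
  ... | no _ | no _ = refl

-- The merged class is the disjoint union of the two old ones, so its indicator is the `xor` of
-- theirs.
Merge-parity-on : ∀ {N} {ℓ ℓ′ : Fin N → ℕ} {i j} → Merge ℓ ℓ′ i j →
  parity ℓ′ i ≡ parity ℓ i xor parity ℓ j
Merge-parity-on {ℓ = ℓ} {ℓ′} {i} {j} m =
  trans (sum-cong-≗ pointwise) (∑-distrib-+ (λ l → does (ℓ i ≟ˡ ℓ l)) (λ l → does (ℓ j ≟ˡ ℓ l)))
  where
  pointwise : ∀ l → does (ℓ′ i ≟ˡ ℓ′ l) ≡ does (ℓ i ≟ˡ ℓ l) xor does (ℓ j ≟ˡ ℓ l)
  pointwise l with ℓ i ≟ˡ ℓ l | ℓ j ≟ˡ ℓ l | ℓ′ i ≟ˡ ℓ′ l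
  ... | yes p | yes q | _ = ⊥-elim (apart m (trans p (sym q)))
  ... | yes p | no q | yes r = refl
  ... | yes p | no q | no r = ⊥-elim (r (keep m p))
  ... | no p | yes q | yes r = refl
  ... | no p | yes q | no r = ⊥-elim (r (trans (glue m) (keep m q)))
  ... | no p | no q | no r = refl
  ... | no p | no q | yes r with only m r
  ...   | inj₁ u = ⊥-elim (p u)
  ...   | inj₂ (inj₁ (_ , u)) = ⊥-elim (q (sym u))
  ...   | inj₂ (inj₂ (u , _)) = ⊥-elim (apart m u)

Merge-parity-off : ∀ {N} {ℓ ℓ′ : Fin N → ℕ} {i j} → Merge ℓ ℓ′ i j →
  ∀ {k} → ℓ′ k ≢ ℓ′ i → parity ℓ′ k ≡ parity ℓ k
Merge-parity-off {ℓ = ℓ} {ℓ′} {i} {j} m {k} off = sum-cong-≗ pointwise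
  where
  pointwise : ∀ l → does (ℓ′ k ≟ˡ ℓ′ l) ≡ does (ℓ k ≟ˡ ℓ l)
  pointwise l with ℓ′ k ≟ˡ ℓ′ l | ℓ k ≟ˡ ℓ l
  ... | yes _ | yes _ = refl
  ... | no _ | no _ = refl
  ... | no p | yes q = ⊥-elim (p (keep m q))
  ... | yes p | no q with only m p
  ...   | inj₁ u = ⊥-elim (q u)
  ...   | inj₂ (inj₁ (u , _)) = ⊥-elim (off (keep m u))
  ...   | inj₂ (inj₂ (u , _)) = ⊥-elim (off (trans (keep m u) (sym (glue m))))

-- Merging three classes.

record Merge₃ {N} (ℓ ℓ′ : Fin N → ℕ) (a b c : Fin N) : Set where
  field
    a≁b        : ℓ a ≢ ℓ b
    b≁c        : ℓ b ≢ ℓ c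
    a≁c        : ℓ a ≢ ℓ c
    only₃      : ∀ k → ℓ′ k ≡ ℓ′ a → ℓ k ≡ ℓ a ⊎ ℓ k ≡ ℓ b ⊎ ℓ k ≡ ℓ c
    parity-on  : parity ℓ′ a ≡ parity ℓ a xor (parity ℓ b xor parity ℓ c)
    parity-off : ∀ k → ℓ′ k ≢ ℓ′ a → parity ℓ′ k ≡ parity ℓ k
open Merge₃

merge-merge : ∀ {N} {ℓ ℓ₁ ℓ₂ : Fin N → ℕ} {a b c} →
  Merge ℓ ℓ₁ b c → Merge ℓ₁ ℓ₂ a b → Merge₃ ℓ ℓ₂ a b c
merge-merge m₁ m₂ .a≁b p = apart m₂ (keep m₁ p)
merge-merge m₁ m₂ .b≁c = apart m₁
merge-merge m₁ m₂ .a≁c p = apart m₂ (trans (keep m₁ p) (sym (glue m₁)))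
merge-merge {ℓ = ℓ} {ℓ₁} {a = a} {b} {c} m₁ m₂ .only₃ k p = fromℓ₁ (only m₂ p)
  where
  toB : ℓ₁ k ≡ ℓ₁ b → ℓ k ≡ ℓ a ⊎ ℓ k ≡ ℓ b ⊎ ℓ k ≡ ℓ c
  toB q with only m₁ q
  ... | inj₁ u = inj₂ (inj₁ u)
  ... | inj₂ (inj₁ (u , _)) = inj₂ (inj₁ u)
  ... | inj₂ (inj₂ (u , _)) = inj₂ (inj₂ u)
  toA : ℓ₁ k ≡ ℓ₁ a → ℓ k ≡ ℓ a ⊎ ℓ k ≡ ℓ b ⊎ ℓ k ≡ ℓ c
  toA q with only m₁ q
  ... | inj₁ u = inj₁ u
  ... | inj₂ (inj₁ (u , _)) = inj₂ (inj₁ u)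
  ... | inj₂ (inj₂ (u , _)) = inj₂ (inj₂ u)
  fromℓ₁ : ℓ₁ k ≡ ℓ₁ a ⊎ (ℓ₁ k ≡ ℓ₁ a × ℓ₁ a ≡ ℓ₁ b) ⊎ (ℓ₁ k ≡ ℓ₁ b × ℓ₁ a ≡ ℓ₁ a) →
           ℓ k ≡ ℓ a ⊎ ℓ k ≡ ℓ b ⊎ ℓ k ≡ ℓ c
  fromℓ₁ (inj₁ q) = toA q
  fromℓ₁ (inj₂ (inj₁ (q , _))) = toA q
  fromℓ₁ (inj₂ (inj₂ (q , _))) = toB q
merge-merge {ℓ = ℓ} {ℓ₁} {a = a} {b} m₁ m₂ .parity-on
  -- The class of `a` is still apart from that of `b` after the first merge, so that merge left its
  -- parity alone.
  rewrite sym (Merge-parity-on m₁) | sym (Merge-parity-off m₁ {a} (apart m₂)) = Merge-parity-on m₂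
merge-merge {ℓ₁ = ℓ₁} {ℓ₂} {a} {b} m₁ m₂ .parity-off k off =
  trans (Merge-parity-off m₂ off)
        (Merge-parity-off m₁ (λ p → off (trans (keep m₂ p) (sym (glue m₂)))))

AllOdd-merge : ∀ {N} {ℓ ℓ′ : Fin N → ℕ} {a b c} → Merge₃ ℓ ℓ′ a b c → AllOdd ℓ → AllOdd ℓ′
AllOdd-merge {ℓ = ℓ} {ℓ′} {a} {b} {c} m odd k with ℓ′ k ≟ˡ ℓ′ a
... | no p = trans (parity-off m k p) (odd k)
... | yes p = trans (parity-label ℓ′ {k} {a} p) (trans (parity-on m) sum-odd)
  where
  sum-odd : parity ℓ a xor (parity ℓ b xor parity ℓ c) ≡ true
  sum-odd rewrite odd a | odd b | odd c = refl

AllOdd-unmerge : ∀ {N} {ℓ ℓ′ : Fin N → ℕ} {a b c} → Merge₃ ℓ ℓ′ a b c → AllOdd ℓ′ →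
  parity ℓ a ≡ true → parity ℓ b ≡ true → parity ℓ c ≡ true → AllOdd ℓ
AllOdd-unmerge {ℓ = ℓ} {ℓ′} {a} {b} {c} m odd pa pb pc k with ℓ′ k ≟ˡ ℓ′ a
... | no p = trans (sym (parity-off m k p)) (odd k)
... | yes p with only₃ m k p
...   | inj₁ q = trans (parity-label ℓ {k} {a} q) pa
...   | inj₂ (inj₁ q) = trans (parity-label ℓ {k} {b} q) pb
...   | inj₂ (inj₂ q) = trans (parity-label ℓ {k} {c} q) pc

-- Even classes come in pairs inside {a, b, c}, and each pair would also be merged by {u, v, w}.
AllOdd-between : ∀ {N} {ℓ ℓ₁ ℓ₂ : Fin N → ℕ} {a b c u v w} →
  Merge₃ ℓ ℓ₁ a b c → Merge₃ ℓ ℓ₂ u v w → AllOdd ℓ₁ → AllOdd ℓ₂ →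
  ℓ₂ a ≢ ℓ₂ b → ℓ₂ b ≢ ℓ₂ c → ℓ₂ a ≢ ℓ₂ c → AllOdd ℓ
AllOdd-between {ℓ = ℓ} {ℓ₁} {ℓ₂} {a} {b} {c} {u} m₁ m₂ odd₁ odd₂ ab bc ac = all
  where
  even⇒u : ∀ k → parity ℓ k ≡ false → ℓ₂ k ≡ ℓ₂ u
  even⇒u k even with ℓ₂ k ≟ˡ ℓ₂ u
  ... | yes p = p
  ... | no p with trans (sym even) (trans (sym (parity-off m₂ k p)) (odd₂ k))
  ...   | ()
  even-even : ∀ k l → parity ℓ k ≡ false → parity ℓ l ≡ false → ℓ₂ k ≡ ℓ₂ l
  even-even k l p q = trans (even⇒u k p) (sym (even⇒u l q))
  all : AllOdd ℓ
  all with parity ℓ a in pa | parity ℓ b in pb | parity ℓ c in pc | trans (sym (parity-on m₁)) (odd₁ a)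
  ... | true  | true  | true  | _ = AllOdd-unmerge m₁ odd₁ pa pb pc
  ... | false | false | _     | _ = ⊥-elim (ab (even-even a b pa pb))
  ... | false | true  | false | _ = ⊥-elim (ac (even-even a c pa pc))
  ... | true  | false | false | _ = ⊥-elim (bc (even-even b c pb pc))
  ... | false | true  | true  | ()
  ... | true  | false | true  | ()
  ... | true  | true  | false | ()

-- Cycle lengths by iteration, compared with label classes.

perm-injective : ∀ {N} (x : Perm N) → Inj (x ⟨$⟩ʳ_)
perm-injective x eq = trans (sym (inverseˡ x)) (trans (cong (x ⟨$⟩ˡ_) eq) (inverseˡ x))

pow-+ : ∀ {N} (x : Perm N) a b i → pow x (a + b) i ≡ pow x a (pow x b i)
pow-+ x zero b i = refl
pow-+ x (suc a) b i = cong (x ⟨$⟩ʳ_) (pow-+ x a b i)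

pow-injective : ∀ {N} (x : Perm N) a {i j} → pow x a i ≡ pow x a j → i ≡ j
pow-injective x zero eq = eq
pow-injective x (suc a) eq = pow-injective x a (perm-injective x eq)

-- Among the N + 1 iterates with exponents 0 to N two coincide, and injectivity cancels the smaller
-- exponent.
pow-recurs : ∀ {N} (x : Perm N) i → ∃ λ d → pow x (suc d) i ≡ i
pow-recurs {N} x i with pigeonhole {N} ≤-refl (λ a → pow x (toℕ a) i)
... | a , b , a<b , eq with m≤n⇒∃[o]m+o≡n a<b
...   | d , suca+d≡b = d , sym (pow-injective x (toℕ a) (trans eq shifted))
  where
  shifted : pow x (toℕ b) i ≡ pow x (toℕ a) (pow x (suc d) i)
  shifted = trans (cong (λ m → pow x m i) (trans (sym suca+d≡b) (sym (+-suc (toℕ a) d))))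
                  (pow-+ x (toℕ a) (suc d) i)

least : ∀ {P : ℕ → Set} → (∀ n → Dec (P n)) → ∀ n → P n → ∃ λ m → P m × (∀ l → l < m → ¬ P l)
least {P} P? n Pn with below (suc n)
  where
  below : ∀ n → (∃ λ m → P m × (∀ l → l < m → ¬ P l)) ⊎ (∀ l → l < n → ¬ P l)
  below zero = inj₂ λ _ ()
  below (suc n) with below n
  ... | inj₁ found = inj₁ found
  ... | inj₂ none with P? n
  ...   | yes p = inj₁ (n , p , none)
  ...   | no ¬p = inj₂ λ l l<1+n → extended l (m<1+n⇒m<n∨m≡n l<1+n)
    where
    extended : ∀ l → l < n ⊎ l ≡ n → ¬ P l
    extended l (inj₁ l<n) = none l l<n
    extended l (inj₂ refl) = ¬p
... | inj₁ found = found
... | inj₂ none = ⊥-elim (none n ≤-refl Pn)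

cycleLen : ∀ {N} (x : Perm N) i → ∃ (CycleLen x i)
cycleLen x i with least (λ d → pow x (suc d) i ≟ i) (proj₁ (pow-recurs x i)) (proj₂ (pow-recurs x i))
... | d , closes , minimal = suc d , s≤s z≤n , closes , positive
  where
  positive : ∀ m → 1 ≤ m → m < suc d → pow x m i ≢ i
  positive (suc m) _ (s≤s m<d) = minimal m m<d

xorUpTo : ℕ → (ℕ → Bool) → Bool
xorUpTo zero a = false
xorUpTo (suc k) a = xorUpTo k a xor a k

xorUpTo-cong : ∀ k {a b : ℕ → Bool} → a ≗ b → xorUpTo k a ≡ xorUpTo k b
xorUpTo-cong zero eq = refl
xorUpTo-cong (suc k) eq = cong₂ _xor_ (xorUpTo-cong k eq) (eq k)

xor-swapʳ : ∀ p q r → (p xor q) xor r ≡ (p xor r) xor q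
xor-swapʳ p q r = trans (xor-assoc p q r) (trans (cong (p xor_) (xor-comm q r)) (sym (xor-assoc p r q)))

xor-cancelʳ : ∀ r {p q} → p xor r ≡ q xor r → p ≡ q
xor-cancelʳ r {true} {true} eq = refl
xor-cancelʳ r {false} {false} eq = refl
xor-cancelʳ true {true} {false} ()
xor-cancelʳ false {true} {false} ()
xor-cancelʳ true {false} {true} ()
xor-cancelʳ false {false} {true} ()

-- Both sides add up `a 0` to `a k`.
xorUpTo-shift : ∀ k a → xorUpTo k (a ∘ suc) xor a 0 ≡ xorUpTo k a xor a k
xorUpTo-shift zero a = refl
xorUpTo-shift (suc k) a =
  trans (xor-swapʳ (xorUpTo k (a ∘ suc)) _ _) (cong (_xor a (suc k)) (xorUpTo-shift k a))

xorUpTo-head : ∀ k a → 1 ≤ k → a 0 ≡ true → (∀ m → 1 ≤ m → m < k → a m ≡ false) → xorUpTo k a ≡ true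
xorUpTo-head (suc zero) a _ a0 rest = a0
xorUpTo-head (suc (suc k)) a _ a0 rest =
  cong₂ _xor_ (xorUpTo-head (suc k) a (s≤s z≤n) a0 (λ m 1≤m m<k → rest m 1≤m (m<n⇒m<1+n m<k)))
              (rest (suc k) (s≤s z≤n) ≤-refl)

xorUpTo-false : ∀ k a → (∀ m → a m ≡ false) → xorUpTo k a ≡ false
xorUpTo-false zero a eq = refl
xorUpTo-false (suc k) a eq = cong₂ _xor_ (xorUpTo-false k a eq) (eq k)

xorUpTo-odd : ∀ k → Odd k → xorUpTo k (λ _ → true) ≡ true
xorUpTo-odd _ (m , refl) = cong (_xor true) (twice m)
  where
  twice : ∀ m → xorUpTo (2 * m) (λ _ → true) ≡ false
  twice zero = refl
  twice (suc m) rewrite +-suc m (m + 0) | twice m = refl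

sum-xorUpTo : ∀ {N} k (a : Fin N → ℕ → Bool) →
  sum (λ l → xorUpTo k (a l)) ≡ xorUpTo k (λ m → sum (λ l → a l m))
sum-xorUpTo {N} zero a = sum-replicate-zero N
sum-xorUpTo (suc k) a =
  trans (∑-distrib-+ (λ l → xorUpTo k (a l)) (λ l → a l k))
        (cong (_xor sum (λ l → a l k)) (sum-xorUpTo k a))

does-injective : ∀ {N} {f : Fin N → Fin N} → Inj f → ∀ a b → does (f a ≟ f b) ≡ does (a ≟ b)
does-injective {f = f} inj a b with f a ≟ f b | a ≟ b
... | yes _ | yes _ = refl
... | no _ | no _ = refl
... | yes p | no ¬q = ⊥-elim (¬q (inj p))
... | no ¬p | yes q = ⊥-elim (¬p (cong f q))

-- The indicator of the orbit of i is x-invariant because pow x k i ≡ i, so it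
-- agrees with the indicator of the label class of i.
oddCycles⇒AllOdd : ∀ {N} (x : Perm N) → OnlyOddCycles x → AllOdd (label (x ⟨$⟩ʳ_))
oddCycles⇒AllOdd {N} x odd i with cycleLen x i
... | k , 1≤k , closes , minimal =
  trans (sum-cong-≗ class≗orbit)
    -- Double counting: each of the `k` exponents hits exactly one point, so the class has the
    -- parity of `k`.
    (trans (sum-xorUpTo k (λ l m → does (pow x m i ≟ l)))
      (trans (xorUpTo-cong k (λ m → sum-δ (pow x m i))) (xorUpTo-odd k (odd i k (1≤k , closes , minimal)))))
  where
  ℓ : Fin N → ℕ
  ℓ = label (x ⟨$⟩ʳ_)
  orbit : Fin N → Bool
  orbit l = xorUpTo k (λ m → does (pow x m i ≟ l))
  orbit-invariant : ∀ l → orbit (x ⟨$⟩ʳ l) ≡ orbit l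
  -- By injectivity of `x`, `orbit l` adds `a 1` to `a k`, while the other side adds `a 0` to
  -- `a (k - 1)`; `closes` makes `a k` equal to `a 0`.
  orbit-invariant l = sym (trans
    (xorUpTo-cong k (λ m → sym (does-injective (perm-injective x) (pow x m i) l)))
    (xor-cancelʳ (a 0) (trans (xorUpTo-shift k a)
      (cong (λ z → xorUpTo k a xor does (z ≟ (x ⟨$⟩ʳ l))) closes))))
    where
    a : ℕ → Bool
    a m = does (pow x m i ≟ (x ⟨$⟩ʳ l))
  orbit-start : orbit i ≡ true
  orbit-start = xorUpTo-head k _ 1≤k (dec-true (i ≟ i) refl)
    (λ m 1≤m m<k → dec-false (pow x m i ≟ i) (minimal m 1≤m m<k))
  ℓ-pow : ∀ m → ℓ (pow x m i) ≡ ℓ i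
  ℓ-pow zero = refl
  ℓ-pow (suc m) = trans (label-step (x ⟨$⟩ʳ_) (perm-injective x) (pow x m i)) (ℓ-pow m)
  class≗orbit : ∀ l → does (ℓ i ≟ˡ ℓ l) ≡ orbit l
  class≗orbit l with ℓ i ≟ˡ ℓ l
  ... | yes p = trans (sym orbit-start) (invariant⇒label (x ⟨$⟩ʳ_) orbit orbit-invariant p)
  ... | no ¬p = sym (xorUpTo-false k _ (λ m → dec-false (pow x m i ≟ l)
                  (λ q → ¬p (trans (sym (ℓ-pow m)) (cong ℓ q)))))

-- Rank and the length ℓ₂.

labels : ∀ {N} → Perm N → Fin N → ℕ
labels w = label (w ⟨$⟩ʳ_)

rk : ∀ {N} → Perm N → ℕ
rk w = rank (w ⟨$⟩ʳ_)

OddCycles : ∀ {N} → Perm N → Set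
OddCycles w = AllOdd (labels w)

OddCycles-cong : ∀ {N} {v w : Perm N} → v ≈ w → OddCycles v → OddCycles w
OddCycles-cong v≈w odd k = trans (sym (parity-cong (label-cong v≈w) k)) (odd k)

-- The indicator of a fixed point is `w`-invariant, hence constant on label classes.
fixed⇒singleton : ∀ {N} (w : Perm N) {i} → w ⟨$⟩ʳ i ≡ i → ∀ l → labels w i ≡ labels w l → i ≡ l
fixed⇒singleton w {i} fixed l eq with i ≟ l | invariant⇒label (w ⟨$⟩ʳ_) (λ k → does (i ≟ k)) invariant eq
  where
  invariant : ∀ k → does (i ≟ (w ⟨$⟩ʳ k)) ≡ does (i ≟ k)
  invariant k = trans (cong (λ z → does (z ≟ (w ⟨$⟩ʳ k))) (sym fixed)) (does-injective (perm-injective w) i k)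
... | yes i≡l | _ = i≡l
... | no _ | eq′ with trans (sym (dec-true (i ≟ i) refl)) eq′
...   | ()

fixed⇒odd : ∀ {N} (w : Perm N) {i} → w ⟨$⟩ʳ i ≡ i → parity (labels w) i ≡ true
fixed⇒odd w {i} fixed = parity-singleton (labels w) i (fixed⇒singleton w fixed)

transposition-step : ∀ {N} (w v : Perm N) {i j} → i ≢ j → v ≈ transpose i j · w →
  Outcome (labels w) (rk w) (labels v) (rk v) i j
transposition-step w v i≢j eq = compare _ _ (perm-injective w) _ _ i≢j eq

Outcome-≤ : ∀ {N} {ℓ ℓ′ : Fin N → ℕ} {r r′ i j} → Outcome ℓ r ℓ′ r′ i j → r′ ≤ suc r
Outcome-≤ (merged _ refl) = ≤-refl
Outcome-≤ (split _ refl) = ≤-trans (n≤1+n _) (n≤1+n _)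

Outcome-merge : ∀ {N} {ℓ ℓ′ : Fin N → ℕ} {r r′ i j} → Outcome ℓ r ℓ′ r′ i j → r′ ≡ suc r → Merge ℓ ℓ′ i j
Outcome-merge (merged m _) _ = m
Outcome-merge (split _ refl) ()

Outcome-apart : ∀ {N} {ℓ ℓ′ : Fin N → ℕ} {r r′ i j} → Outcome ℓ r ℓ′ r′ i j → ℓ i ≢ ℓ j →
  Merge ℓ ℓ′ i j × r′ ≡ suc r
Outcome-apart (merged m r) _ = m , r
Outcome-apart (split p _) ne = ⊥-elim (ne p)

Outcome-split : ∀ {N} {ℓ ℓ′ : Fin N → ℕ} {r r′ i j} → Outcome ℓ r ℓ′ r′ i j → ℓ i ≡ ℓ j → r ≡ suc r′
Outcome-split (merged m _) p = ⊥-elim (apart m p)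
Outcome-split (split _ r) _ = r

-- Equality in a chain of bounds forces equality in the inner link. This passes additivity of rank
-- from a product to its subproducts.
tight : ∀ p q {a b c} → a ≡ p + (q + c) → a ≤ p + b → b ≤ q + c → b ≡ q + c
tight p q a≡ a≤ b≤ = ≤-antisym b≤ (+-cancelˡ-≤ p _ _ (≤-trans (≤-reflexive (sym a≡)) a≤))

rk-transpositions : ∀ {N} (ts : List (Perm N)) → All IsTransposition ts → ∀ w →
  rk (prod ts · w) ≤ length ts + rk w
rk-transpositions [] [] w = ≤-refl
rk-transpositions (t ∷ ts) ((i , j , i≢j , t≈) ∷ all) w =
  ≤-trans (Outcome-≤ (transposition-step (prod ts · w) (t · (prod ts · w)) i≢j (λ k → t≈ _)))
          (s≤s (rk-transpositions ts all w))

rk≤ : ∀ {N} (w : Perm N) {m} → ProdOf IsTransposition w m → rk w ≤ m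
rk≤ {N} w (ts , all , refl , w≈) =
  ≤-trans (≤-reflexive (rank-cong w≈))
    (≤-trans (rk-transpositions ts all e)
      (≤-reflexive (trans (cong (length ts +_) (rank-id N)) (+-identityʳ _))))

moved : ∀ {N} (w : Perm N) → (∀ i → w ⟨$⟩ʳ i ≡ i) ⊎ (∃ λ i → w ⟨$⟩ʳ i ≢ i)
moved {N} w with all? (λ i → (w ⟨$⟩ʳ i) ≟ i)
... | yes p = inj₁ p
... | no ¬p = inj₂ (¬∀⟶∃¬ N _ (λ i → (w ⟨$⟩ʳ i) ≟ i) ¬p)

-- A moved point and its image lie on one cycle, so multiplying by their transposition splits it and
-- lowers the rank by one.
factor₂ : ∀ {N} n (w : Perm N) → rk w ≡ n → ProdOf IsTransposition w n
factor₂ {N} n w rk≡n with moved w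
... | inj₁ fixed = [] , [] , trans (sym (rank-id N)) (trans (sym (rank-cong fixed)) rk≡n) , fixed
... | inj₂ (i , moves) = peel n rk≡n
  where
  j : Fin N
  j = w ⟨$⟩ʳ i
  v : Perm N
  v = transpose i j · w
  drops : rk w ≡ suc (rk v)
  drops = Outcome-split (transposition-step w v (λ p → moves (sym p)) (λ _ → refl))
            (sym (label-step (w ⟨$⟩ʳ_) (perm-injective w) i))
  peel : ∀ n → rk w ≡ n → ProdOf IsTransposition w n
  peel zero p with trans (sym p) drops
  ... | ()
  peel (suc n) p with factor₂ n v (suc-injective (trans (sym drops) p))
  ... | ts , all , len , v≈ =
    transpose i j ∷ ts , (i , j , (λ q → moves (sym q)) , λ _ → refl) ∷ all , cong suc len ,
    λ k → trans (sym (swap-involutive i j (w ⟨$⟩ʳ k))) (cong (swap i j) (v≈ k))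

len₂ : ∀ {N} (w : Perm N) → Len₂ w (rk w)
len₂ w = factor₂ (rk w) w refl , λ m → rk≤ w

len₂-unique : ∀ {N} (w : Perm N) {k} → Len₂ w k → k ≡ rk w
len₂-unique w (prods , minimal) = ≤-antisym (minimal _ (factor₂ (rk w) w refl)) (rk≤ w prods)

rk-· : ∀ {N} (y w : Perm N) → rk (y · w) ≤ rk y + rk w
rk-· y w with factor₂ (rk y) y refl
... | ts , all , len , y≈ =
  ≤-trans (≤-reflexive (rank-cong {f = (y · w) ⟨$⟩ʳ_} (λ k → y≈ (w ⟨$⟩ʳ k))))
    (≤-trans (rk-transpositions ts all w) (≤-reflexive (cong (_+ rk w) len)))

-- Multiplication by 3-cycles.

threeCycle-≤ : ∀ {N} (w v : Perm N) {a b c} → a ≢ b → b ≢ c → v ≈ threeCycle a b c · w → rk v ≤ 2 + rk w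
threeCycle-≤ w v {a} {b} {c} a≢b b≢c v≈ =
  ≤-trans (Outcome-≤ (transposition-step (transpose b c · w) v a≢b v≈))
          (s≤s (Outcome-≤ (transposition-step w (transpose b c · w) b≢c (λ _ → refl))))

-- Each of the two transpositions raises the rank by at most one, so a gain of two forces both to
-- merge.
threeCycle-merge : ∀ {N} (w v : Perm N) {a b c} → a ≢ b → b ≢ c → v ≈ threeCycle a b c · w →
  rk v ≡ 2 + rk w → Merge₃ (labels w) (labels v) a b c
threeCycle-merge w v {a} {b} {c} a≢b b≢c v≈ up =
  merge-merge (Outcome-merge first mid≡) (Outcome-merge second (trans up (cong suc (sym mid≡))))
  where
  mid : Perm _
  mid = transpose b c · w
  first : Outcome (labels w) (rk w) (labels mid) (rk mid) b c
  first = transposition-step w mid b≢c (λ _ → refl)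
  second : Outcome (labels mid) (rk mid) (labels v) (rk v) a b
  second = transposition-step mid v a≢b v≈
  mid≡ : rk mid ≡ suc (rk w)
  mid≡ = tight 1 1 up (Outcome-≤ second) (Outcome-≤ first)

conjugate : ∀ {N} (w : Perm N) → Perm N → Perm N
conjugate w t = w · t · w ⁻¹

-- Turns right multiplication into left multiplication by a conjugate, so that the results on left
-- multiplication carry over.
·-conjugate : ∀ {N} (w t : Perm N) → w · t ≈ conjugate w t · w
·-conjugate w t k = cong (λ z → w ⟨$⟩ʳ (t ⟨$⟩ʳ z)) (sym (inverseˡ w))

conjugate-threeCycle : ∀ {N} (w t : Perm N) → IsThreeCycle t → IsThreeCycle (conjugate w t)
conjugate-threeCycle w t (a , b , c , a≢b , b≢c , a≢c , t≈) =
  w ⟨$⟩ʳ a , w ⟨$⟩ʳ b , w ⟨$⟩ʳ c , a≢b ∘ inj , b≢c ∘ inj , a≢c ∘ inj , λ k →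
  trans (cong (w ⟨$⟩ʳ_) (t≈ _)) (trans (swap-natural (w ⟨$⟩ʳ_) inj a b _)
    (cong (swap (w ⟨$⟩ʳ a) (w ⟨$⟩ʳ b))
      (trans (swap-natural (w ⟨$⟩ʳ_) inj b c _)
             (cong (swap (w ⟨$⟩ʳ b) (w ⟨$⟩ʳ c)) (inverseʳ w)))))
  where
  inj : Inj (w ⟨$⟩ʳ_)
  inj = perm-injective w

rk-3ˡ : ∀ {N} (t : Perm N) → IsThreeCycle t → ∀ w → rk (t · w) ≤ 2 + rk w
rk-3ˡ t (a , b , c , a≢b , b≢c , _ , t≈) w = threeCycle-≤ w (t · w) a≢b b≢c (λ _ → t≈ _)

rk-conjugate : ∀ {N} (w t : Perm N) → rk (w · t) ≡ rk (conjugate w t · w)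
rk-conjugate w t = rank-cong (·-conjugate w t)

rk-3ʳ : ∀ {N} (t : Perm N) → IsThreeCycle t → ∀ w → rk (w · t) ≤ 2 + rk w
rk-3ʳ t 3c w = ≤-trans (≤-reflexive (rk-conjugate w t)) (rk-3ˡ (conjugate w t) (conjugate-threeCycle w t 3c) w)

OddCycles-3ˡ : ∀ {N} (t : Perm N) → IsThreeCycle t → ∀ w → rk (t · w) ≡ 2 + rk w →
  OddCycles w → OddCycles (t · w)
OddCycles-3ˡ t (a , b , c , a≢b , b≢c , _ , t≈) w up =
  AllOdd-merge (threeCycle-merge w (t · w) a≢b b≢c (λ _ → t≈ _) up)

OddCycles-3ʳ : ∀ {N} (t : Perm N) → IsThreeCycle t → ∀ w → rk (w · t) ≡ 2 + rk w →
  OddCycles w → OddCycles (w · t)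
OddCycles-3ʳ t 3c w up odd =
  OddCycles-cong {v = conjugate w t · w} {w · t} (λ k → sym (·-conjugate w t k))
    (OddCycles-3ˡ (conjugate w t) (conjugate-threeCycle w t 3c) w (trans (sym (rk-conjugate w t)) up) odd)

double : ℕ → ℕ
double zero    = zero
double (suc k) = 2 + double k

double-+ : ∀ a b → double (a + b) ≡ double a + double b
double-+ zero b = refl
double-+ (suc a) b = cong (2 +_) (double-+ a b)

double-cancel-≤ : ∀ a b → double a ≤ double b → a ≤ b
double-cancel-≤ zero b _ = z≤n
double-cancel-≤ (suc a) (suc b) (s≤s (s≤s p)) = s≤s (double-cancel-≤ a b p)

double-injective : ∀ {a b} → double a ≡ double b → a ≡ b
double-injective p =
  ≤-antisym (double-cancel-≤ _ _ (≤-reflexive p)) (double-cancel-≤ _ _ (≤-reflexive (sym p)))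

rk-prodˡ : ∀ {N} (ts : List (Perm N)) → All IsThreeCycle ts → ∀ w →
  rk (prod ts · w) ≤ double (length ts) + rk w
rk-prodˡ [] [] w = ≤-refl
rk-prodˡ (t ∷ ts) (3c ∷ all) w =
  ≤-trans (rk-3ˡ t 3c (prod ts · w)) (s≤s (s≤s (rk-prodˡ ts all w)))

+-2 : ∀ n m → n + (2 + m) ≡ 2 + (n + m)
+-2 n m = trans (+-suc n (suc m)) (cong suc (+-suc n m))

rk-prodʳ : ∀ {N} (ts : List (Perm N)) → All IsThreeCycle ts → ∀ w →
  rk (w · prod ts) ≤ double (length ts) + rk w
rk-prodʳ [] [] w = ≤-refl
rk-prodʳ (t ∷ ts) (3c ∷ all) w =
  ≤-trans (rk-prodʳ ts all (w · t))
    (≤-trans (+-monoʳ-≤ (double (length ts)) (rk-3ʳ t 3c w))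
             (≤-reflexive (+-2 (double (length ts)) (rk w))))

OddCycles-prodˡ : ∀ {N} (ts : List (Perm N)) → All IsThreeCycle ts → ∀ w →
  rk (prod ts · w) ≡ double (length ts) + rk w → OddCycles w → OddCycles (prod ts · w)
OddCycles-prodˡ [] [] w up odd = odd
OddCycles-prodˡ (t ∷ ts) (3c ∷ all) w up odd =
  OddCycles-3ˡ t 3c (prod ts · w) (trans up (cong (2 +_) (sym inner)))
    (OddCycles-prodˡ ts all w inner odd)
  where
  inner : rk (prod ts · w) ≡ double (length ts) + rk w
  inner = tight 2 (double (length ts)) up (rk-3ˡ t 3c (prod ts · w)) (rk-prodˡ ts all w)

-- Odd cycles of a middle factor.

-- As `t` also gains full rank on `w · s`, its three points lie on distinct cycles of `w · s`; so
-- `s` has merged no two of them, as `AllOdd-between` requires.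
OddCycles-between₁ : ∀ {N} (t s : Perm N) → IsThreeCycle t → IsThreeCycle s → ∀ w →
  rk (t · w) ≡ 2 + rk w → rk (w · s) ≡ 2 + rk w → rk (t · (w · s)) ≡ 2 + rk (w · s) →
  OddCycles (t · w) → OddCycles (w · s) → OddCycles w
OddCycles-between₁ t s (a , b , c , a≢b , b≢c , _ , t≈) 3c w up-tw up-ws up-tws odd-tw odd-ws
  with conjugate-threeCycle w s 3c
... | u , v , z , u≢v , v≢z , _ , s≈ =
  AllOdd-between
    (threeCycle-merge w (t · w) a≢b b≢c (λ _ → t≈ _) up-tw)
    (threeCycle-merge w (w · s) u≢v v≢z (λ k → trans (·-conjugate w s k) (s≈ _)) up-ws)
    odd-tw odd-ws (a≁b outer) (b≁c outer) (a≁c outer)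
  where
  outer : Merge₃ (labels (w · s)) (labels (t · (w · s))) a b c
  outer = threeCycle-merge (w · s) (t · (w · s)) a≢b b≢c (λ _ → t≈ _) up-tws

-- Induction on `us`: the recursive call shows that `w · s` has odd cycles, and the case of two
-- single 3-cycles then removes `s`.
OddCycles-between₂ : ∀ {N} (t : Perm N) → IsThreeCycle t → ∀ us → All IsThreeCycle us → ∀ w →
  rk (t · (w · prod us)) ≡ double (length us) + (2 + rk w) →
  OddCycles (t · w) → OddCycles (w · prod us) → OddCycles w
OddCycles-between₂ t 3t [] [] w up odd-tw odd-wu = odd-wu
OddCycles-between₂ t 3t (s ∷ us) (3s ∷ all) w up odd-tw odd-wu =
  OddCycles-between₁ t s 3t 3s w up-tw up-ws (trans tws≡ (cong (2 +_) (sym up-ws))) odd-tw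
    (OddCycles-between₂ t 3t us all (w · s)
      (trans up′ (cong (λ n → double (length us) + (2 + n)) (sym up-ws)))
      -- The cycles of `t · w` are odd and `s` gains full rank on it. Both bracketings of the triple
      -- product have the same underlying function by computation.
      (OddCycles-3ʳ s 3s (t · w) (trans tws≡ (cong (2 +_) (sym up-tw))) odd-tw) odd-wu)
  where
  up′ : rk (t · (w · (s · prod us))) ≡ double (length us) + (2 + (2 + rk w))
  up′ = trans up (sym (+-2 (double (length us)) (2 + rk w)))
  tws≡ : rk (t · (w · s)) ≡ 2 + (2 + rk w)
  tws≡ = tight (double (length us)) 2 up′ (rk-prodʳ us all (t · (w · s)))
           (≤-trans (rk-3ˡ t 3t (w · s)) (s≤s (s≤s (rk-3ʳ s 3s w))))
  up-ws : rk (w · s) ≡ 2 + rk w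
  up-ws = tight 2 2 tws≡ (rk-3ˡ t 3t (w · s)) (rk-3ʳ s 3s w)
  up-tw : rk (t · w) ≡ 2 + rk w
  up-tw = tight 2 2 tws≡ (rk-3ʳ s 3s (t · w)) (rk-3ˡ t 3t w)

-- Induction on `ys`: first `t` is removed, with `y · w` as middle factor, and the recursive call
-- then removes `y`. The product `y · (w · u)` has odd cycles because `y` gains full rank on
-- `w · u`.
OddCycles-between : ∀ {N} (ys us : List (Perm N)) → All IsThreeCycle ys → All IsThreeCycle us → ∀ w →
  rk (prod ys · (w · prod us)) ≡ double (length ys) + (double (length us) + rk w) →
  OddCycles (prod ys · w) → OddCycles (w · prod us) → OddCycles w
OddCycles-between [] us [] all-us w up odd-yw odd-wu = odd-yw
OddCycles-between (t ∷ ys) us (3t ∷ all-ys) all-us w up odd-yw odd-wu =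
  OddCycles-between ys us all-ys all-us w up-ywu
    (OddCycles-between₂ t 3t us all-us (y · w)
      (trans up (trans (cong (2 +_) (trans Y-comm (cong (U +_) (sym up-yw)))) (sym (+-2 U _))))
      odd-yw (OddCycles-prodˡ ys all-ys (w · u) (trans up-ywu (cong (Y +_) (sym up-wu))) odd-wu))
    odd-wu
  where
  y = prod ys
  u = prod us
  Y = double (length ys)
  U = double (length us)
  Y-comm : Y + (U + rk w) ≡ U + (Y + rk w)
  Y-comm = trans (sym (+-assoc Y U _)) (trans (cong (_+ rk w) (+-comm Y U)) (+-assoc U Y _))
  wu≤ : rk (w · u) ≤ U + rk w
  wu≤ = rk-prodʳ us all-us w
  ywu≤ : rk (y · (w · u)) ≤ Y + rk (w · u)
  ywu≤ = rk-prodˡ ys all-ys (w · u)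
  up-ywu : rk (y · (w · u)) ≡ Y + (U + rk w)
  up-ywu = tight 2 Y up (rk-3ˡ t 3t (y · (w · u))) (≤-trans ywu≤ (+-monoʳ-≤ Y wu≤))
  up-wu : rk (w · u) ≡ U + rk w
  up-wu = tight Y U up-ywu ywu≤ wu≤
  up-yw : rk (y · w) ≡ Y + rk w
  -- The same total, now read as right multiplication of `y · w` by `u`.
  up-yw = tight U Y (trans up-ywu Y-comm) (rk-prodʳ us all-us (y · w)) (rk-prodˡ ys all-ys w)

-- Odd cycles and the length ℓ₃.

-- A point i on a cycle i ↦ j ↦ k ↦ … of odd length > 1 has k ≢ i, and removing
-- the 3-cycle (i j k) detaches i and j as fixed points.
factor₃ : ∀ {N} n (w : Perm N) → rk w ≤ n → OddCycles w →
  ∃ λ k → ProdOf IsThreeCycle w k × rk w ≡ double k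
factor₃ {N} n w rk≤n odd with moved w
... | inj₁ fixed = 0 , ([] , [] , refl , fixed) , trans (rank-cong fixed) (rank-id N)
... | inj₂ (i , moves) = peel n rk≤n
  where
  j k : Fin N
  j = w ⟨$⟩ʳ i
  k = w ⟨$⟩ʳ j
  i≢j : i ≢ j
  i≢j p = moves (sym p)
  j≢k : j ≢ k
  j≢k p = i≢j (perm-injective w p)
  k≢i : k ≢ i
  -- Otherwise `w` would exchange `i` and `j`, a class merged from two fixed points of `v` and hence
  -- even.
  k≢i k≡i with trans (sym (odd i)) (trans (Merge-parity-on merge) (cong₂ _xor_ (fixed⇒odd v v-i) (fixed⇒odd v v-j)))
    where
    v : Perm N
    v = transpose i j · w
    v-i : v ⟨$⟩ʳ i ≡ i
    v-i = swap-right i j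
    v-j : v ⟨$⟩ʳ j ≡ j
    v-j = trans (cong (swap i j) k≡i) (swap-left i j)
    merge : Merge (labels v) (labels w) i j
    merge = proj₁ (Outcome-apart
      (transposition-step v w i≢j (λ l → sym (swap-involutive i j (w ⟨$⟩ʳ l))))
      (λ p → i≢j (fixed⇒singleton v v-i j p)))
  ... | ()
  v₁ v₂ : Perm N
  v₁ = transpose i j · w
  v₂ = transpose j k · v₁
  v₁-i : v₁ ⟨$⟩ʳ i ≡ i
  v₁-i = swap-right i j
  v₁-j : v₁ ⟨$⟩ʳ j ≡ k
  v₁-j = swap-other k≢i (λ p → j≢k (sym p))
  v₂-i : v₂ ⟨$⟩ʳ i ≡ i
  v₂-i = trans (cong (swap j k) v₁-i) (swap-other i≢j (λ p → k≢i (sym p)))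
  v₂-j : v₂ ⟨$⟩ʳ j ≡ j
  v₂-j = trans (cong (swap j k) v₁-j) (swap-right j k)
  v₁≈ : v₁ ≈ transpose j k · v₂
  v₁≈ l = sym (swap-involutive j k (v₁ ⟨$⟩ʳ l))
  w≈ : w ≈ transpose i j · v₁
  w≈ l = sym (swap-involutive i j (w ⟨$⟩ʳ l))
  low : Merge (labels v₂) (labels v₁) j k × rk v₁ ≡ suc (rk v₂)
  low = Outcome-apart (transposition-step v₂ v₁ j≢k v₁≈) (λ p → j≢k (fixed⇒singleton v₂ v₂-j k p))
  high : Merge (labels v₁) (labels w) i j × rk w ≡ suc (rk v₁)
  high = Outcome-apart (transposition-step v₁ w i≢j w≈) (λ p → i≢j (fixed⇒singleton v₁ v₁-i j p))
  merge : Merge₃ (labels v₂) (labels w) i j k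
  merge = merge-merge (proj₁ low) (proj₁ high)
  rk≡ : rk w ≡ 2 + rk v₂
  rk≡ = trans (proj₂ high) (cong suc (proj₂ low))
  odd-k : parity (labels v₂) k ≡ true
  odd-k with trans (sym (odd i)) (parity-on merge)
  ... | eq rewrite fixed⇒odd v₂ v₂-i | fixed⇒odd v₂ v₂-j = third _ eq
    where
    third : ∀ p → true ≡ true xor (true xor p) → p ≡ true
    third true _ = refl
    third false ()
  odd₂ : OddCycles v₂
  odd₂ = AllOdd-unmerge merge odd (fixed⇒odd v₂ v₂-i) (fixed⇒odd v₂ v₂-j) odd-k
  peel : ∀ n → rk w ≤ n → ∃ λ k → ProdOf IsThreeCycle w k × rk w ≡ double k
  peel zero p with ≤-trans (≤-reflexive (sym rk≡)) p
  ... | ()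
  -- The number `n` merely bounds the rank for termination, so a drop by two is weakened to a drop
  -- by one.
  peel (suc n) p with factor₃ n v₂ (≤-trans (n≤1+n _) (≤-pred (≤-trans (≤-reflexive (sym rk≡)) p))) odd₂
  ... | m , (ts , all , len , v₂≈) , r =
    suc m ,
    (threeCycle i j k ∷ ts ,
     (i , j , k , i≢j , j≢k , (λ q → k≢i (sym q)) , λ _ → refl) ∷ all , cong suc len ,
     λ l → trans (w≈ l) (cong (swap i j) (trans (v₁≈ l) (cong (swap j k) (v₂≈ l))))) ,
    trans rk≡ (cong (2 +_) r)

rk≤double : ∀ {N} (w : Perm N) {m} → ProdOf IsThreeCycle w m → rk w ≤ double m
rk≤double {N} w (ts , all , refl , w≈) =
  ≤-trans (≤-reflexive (rank-cong w≈))
    (≤-trans (rk-prodˡ ts all e)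
      (≤-reflexive (trans (cong (double (length ts) +_) (rank-id N)) (+-identityʳ _))))

-- A factorization that attains the bound `rk≤double` cannot be shortened.
len₃ : ∀ {N} (w : Perm N) {k} → ProdOf IsThreeCycle w k → rk w ≡ double k → Len₃ w k
len₃ w {k} prods eq =
  prods , λ m prods′ → double-cancel-≤ k m (≤-trans (≤-reflexive (sym eq)) (rk≤double w prods′))

len₃-unique : ∀ {N} (w : Perm N) {k m} → Len₃ w k → Len₃ w m → k ≡ m
len₃-unique w (p , min-p) (q , min-q) = ≤-antisym (min-p _ q) (min-q _ p)

-- If the bound is attained, then every factor merges three cycles, starting from the fixed points
-- of `e`; three odd lengths add up to an odd one.
rk≡double⇒OddCycles : ∀ {N} (w : Perm N) {k} → ProdOf IsThreeCycle w k → rk w ≡ double k → OddCycles w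
rk≡double⇒OddCycles {N} w (ts , all , refl , w≈) eq =
  OddCycles-cong {v = prod ts} {w} (λ k → sym (w≈ k))
    (OddCycles-prodˡ ts all e
      (trans (sym (rank-cong w≈)) (trans eq (trans (sym (+-identityʳ _))
        (cong (double (length ts) +_) (sym (rank-id N))))))
      (λ k → fixed⇒odd (e {N}) {k} refl))

-- Comparison of the two orders.

rk-additive⇒≤₂ : ∀ {N} (y z : Perm N) → rk z ≡ rk y + rk (y ⁻¹ · z) → y ≤₂ z
rk-additive⇒≤₂ y z eq = _ , _ , _ , len₂ z , len₂ y , len₂ (y ⁻¹ · z) , eq

≤₂⇒rk-additive : ∀ {N} (y z : Perm N) → y ≤₂ z → rk z ≡ rk y + rk (y ⁻¹ · z)
≤₂⇒rk-additive y z (_ , _ , _ , lz , ly , lw , eq)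
  rewrite len₂-unique z lz | len₂-unique y ly | len₂-unique (y ⁻¹ · z) lw = eq

record Below₃ {N} (y x : Perm N) : Set where
  field
    b c      : ℕ
    len-y    : Len₃ y b
    len-rest : Len₃ (y ⁻¹ · x) c
    rk-y     : rk y ≡ double b
    rk-rest  : rk (y ⁻¹ · x) ≡ double c
    rk-x     : rk x ≡ rk y + rk (y ⁻¹ · x)

-- rk x ≤ rk y + rk (y⁻¹x) ≤ 2 ℓ₃(y) + 2 ℓ₃(y⁻¹x) = 2 ℓ₃(x) = rk x forces equality throughout.
below₃ : ∀ {N} (y x : Perm N) {a} → Len₃ x a → rk x ≡ double a → y ≤₃ x → Below₃ y x
below₃ y x {a} len-x rk-x (a′ , b , c , len-x′ , len-y , len-rest , a′≡b+c) = record
  { b = b ; c = c ; len-y = len-y ; len-rest = len-rest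
  ; rk-y = rk-y ; rk-rest = rk-rest ; rk-x = trans total (cong₂ _+_ (sym rk-y) (sym rk-rest)) }
  where
  total : rk x ≡ double b + double c
  total = trans rk-x (trans (cong double (trans (len₃-unique x len-x len-x′) a′≡b+c)) (double-+ b c))
  y≤ : rk y ≤ double b
  y≤ = rk≤double y (proj₁ len-y)
  rest≤ : rk (y ⁻¹ · x) ≤ double c
  rest≤ = rk≤double (y ⁻¹ · x) (proj₁ len-rest)
  sub : double b + double c ≤ rk y + rk (y ⁻¹ · x)
  sub = ≤-trans (≤-reflexive (trans (sym total) (rank-cong (λ k → sym (inverseʳ y)))))
                (rk-· y (y ⁻¹ · x))
  rk-y : rk y ≡ double b
  rk-y = ≤-antisym y≤ (+-cancelʳ-≤ (double c) _ _ (≤-trans sub (+-monoʳ-≤ (rk y) rest≤)))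
  rk-rest : rk (y ⁻¹ · x) ≡ double c
  rk-rest = ≤-antisym rest≤ (+-cancelˡ-≤ (double b) _ _ (≤-trans sub (+-monoˡ-≤ (rk (y ⁻¹ · x)) y≤)))

-- The outer products are `z` and `y ⁻¹ · x`, whose ranks are twice their ℓ₃, so both have odd
-- cycles. Once `w` has odd cycles too, its rank is also twice its ℓ₃, and halving the additivity of
-- ranks gives that of ℓ₃.
≤₂⇒≤₃ : ∀ {N} {x : Perm N} (y z : Perm N) → Below₃ y x → Below₃ z x → y ≤₂ z → y ≤₃ z
≤₂⇒≤₃ {N} {x} y z Y Z y≤z = conclude
  where
  module Y = Below₃ Y
  module Z = Below₃ Z
  w : Perm N
  w = y ⁻¹ · z
  rk-z : rk z ≡ rk y + rk w
  rk-z = ≤₂⇒rk-additive y z y≤z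
  odd-w : OddCycles w
  odd-w with proj₁ Y.len-y | proj₁ Z.len-rest
  ... | ys , all-ys , len-ys , y≈ | us , all-us , len-us , u≈ =
    OddCycles-between ys us all-ys all-us w total
      (OddCycles-cong {v = z} {prod ys · w} z≈ (rk≡double⇒OddCycles z (proj₁ Z.len-y) Z.rk-y))
      (OddCycles-cong {v = y ⁻¹ · x} {w · prod us} rest≈
        (rk≡double⇒OddCycles (y ⁻¹ · x) (proj₁ Y.len-rest) Y.rk-rest))
    where
    z≈ : z ≈ prod ys · w
    z≈ k = trans (sym (inverseʳ y)) (y≈ _)
    rest≈ : y ⁻¹ · x ≈ w · prod us
    rest≈ k = cong (y ⁻¹ ⟨$⟩ʳ_) (trans (sym (inverseʳ z)) (cong (z ⟨$⟩ʳ_) (u≈ k)))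
    x≈ : prod ys · (w · prod us) ≈ x
    x≈ k = trans (sym (z≈ (prod us ⟨$⟩ʳ k))) (trans (cong (z ⟨$⟩ʳ_) (sym (u≈ k))) (inverseʳ z))
    ys≡ : rk y ≡ double (length ys)
    ys≡ = trans Y.rk-y (cong double (sym len-ys))
    us≡ : rk (z ⁻¹ · x) ≡ double (length us)
    us≡ = trans Z.rk-rest (cong double (sym len-us))
    total : rk (prod ys · (w · prod us)) ≡ double (length ys) + (double (length us) + rk w)
    total = trans (rank-cong x≈) (trans Z.rk-x (trans (cong (_+ rk (z ⁻¹ · x)) rk-z)
      (trans (+-assoc (rk y) (rk w) _) (cong₂ _+_ ys≡ (trans (+-comm (rk w) _) (cong (_+ rk w) us≡))))))
  conclude : y ≤₃ z
  conclude with factor₃ (rk w) w ≤-refl odd-w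
  ... | k , prods , rk-w = Z.b , Y.b , k , Z.len-y , Y.len-y , len₃ w prods rk-w ,
    double-injective (trans (sym Z.rk-y) (trans rk-z (trans (cong₂ _+_ Y.rk-y rk-w) (sym (double-+ Y.b k)))))

theorem4p1 : (N : ℕ) → 3 ≤ N → (x : Perm N) → InAlt x → OnlyOddCycles x →
    ((y : Perm N) → y ∈[ e , x ]₃ → y ∈[ e , x ]₂)
    × ((y z : Perm N) → y ∈[ e , x ]₃ → z ∈[ e , x ]₃ → (y ≤₃ z ⇔ y ≤₂ z))
theorem4p1 N _ x _ odd with factor₃ (rk x) x ≤-refl (oddCycles⇒AllOdd x odd)
... | a , prods , rk-x = inclusion , order
  where
  below : ∀ y → y ∈[ e , x ]₃ → Below₃ y x
  below y (_ , y≤x) = below₃ y x (len₃ x prods rk-x) rk-x y≤x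
  inclusion : (y : Perm N) → y ∈[ e , x ]₃ → y ∈[ e , x ]₂
  inclusion y y∈ =
    rk-additive⇒≤₂ e y (cong (_+ rk y) (sym (rank-id N))) ,
    rk-additive⇒≤₂ y x (Below₃.rk-x (below y y∈))
  order : (y z : Perm N) → y ∈[ e , x ]₃ → z ∈[ e , x ]₃ → (y ≤₃ z ⇔ y ≤₂ z)
  order y z y∈ z∈ = mk⇔
    -- `below₃` is applied with `z` as the upper element: being below `x`, it has rank twice its ℓ₃.
    (λ y≤z → rk-additive⇒≤₂ y z
      (Below₃.rk-x (below₃ y z (Below₃.len-y (below z z∈)) (Below₃.rk-y (below z z∈)) y≤z)))
    (≤₂⇒≤₃ y z (below y y∈) (below z z∈))
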